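{- Let $(W,S)$ be a Coxeter system. Consider the random walk on $W$ started at the identity $1_W$ which, at each step, multiplies the current element on the right by an element chosen uniformly at random from $S \cup \{1_W\}$ (i.e. by each $s\in S$ or by $1_W$, each with probability $\frac{1}{|S|+1}$). Let $P^n(x)$ denote the probability that the walk is at $x\in W$ after $n$ steps. Then for every $n \geq 0$ and all $w, w' \in W$ with $w \leq_B w'$, we have $P^n(w) \geq P^n(w')$.
   Context: A Coxeter system $(W,S)$ is a group $W$ with generating set $S=\{s_1,\dots,s_k\}$ and presentation $\langle s_1,\dots,s_k \mid s_i^2,\ (s_is_j)^{m_{ij}}\ (i\neq j)\rangle$, where each $m_{ij}$ ($i\ne j$) is an integer $\geq 2$ or $\infty$ (meaning no relation). For $x\in W$, $l(x)$ is the length of a shortest word in $S$ representing $x$. The (right) weak Bruhat order $\leq_B$ on $W$ is defined by $w \leq_B w'$ iff there is a reduced word for $w$ which can be extended by multiplying on the right by elements of $S$ to obtain a reduced word for $w'$; equivalently, some shortest path from $1_W$ to $w'$ in the Cayley graph $\Gamma(W,S)$ (edges $x$ — $xs$ for $s\in S$) passes through $w$. -}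

module Defs where

open import Data.Nat using (ℕ; zero; suc; _^_; _≤_; NonZero)
open import Data.Nat.Properties using (m^n≢0)
import Data.Fin
open Data.Fin using (Fin)
open import Data.Maybe using (Maybe; just; nothing)
open import Data.List using (List; []; _∷_; _++_; concat; replicate; length; map)
open import Data.Vec using (Vec; []; _∷_)
open import Data.Product using (Σ; ∃; _×_; _,_)
open import Data.Integer using (+_)
open import Data.Rational using (ℚ; _/_)
open import Relation.Nullary using (¬_)
open import Relation.Binary.PropositionalEquality using (_≡_)

-- A Coxeter matrix on k generators s_0,…,s_{k-1}.
-- m i j = nothing encodes m_ij = ∞ (no relation); m i j = just n encodes m_ij = n.
record CoxeterMatrix (k : ℕ) : Set where
  field
    m     : Fin k → Fin k → Maybe ℕ
    m-sym : ∀ i j → m i j ≡ m j i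
    m-≥2  : ∀ i j → ¬ (i ≡ j) → ∀ n → m i j ≡ just n → 2 ≤ n
open CoxeterMatrix public

Word : ℕ → Set
Word k = List (Fin k)

alt : ∀ {k} → Fin k → Fin k → ℕ → Word k
alt i j n = concat (replicate n (i ∷ j ∷ []))

-- The congruence on words generated by the Coxeter relations.
-- W = Word k / _∼_ is the Coxeter group of the presentation
-- ⟨ s_i | s_i², (s_i s_j)^{m_ij} (i ≠ j, m_ij < ∞) ⟩ (the monoid presentation
-- agrees with the group presentation because every generator is an involution).
data _⊢_∼_ {k : ℕ} (M : CoxeterMatrix k) : Word k → Word k → Set where
  ∼-refl  : ∀ {u} → M ⊢ u ∼ u
  ∼-sym   : ∀ {u v} → M ⊢ u ∼ v → M ⊢ v ∼ u
  ∼-trans : ∀ {u v w} → M ⊢ u ∼ v → M ⊢ v ∼ w → M ⊢ u ∼ w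
  ∼-cong  : ∀ {u v} (a b : Word k) → M ⊢ u ∼ v → M ⊢ (a ++ u ++ b) ∼ (a ++ v ++ b)
  ∼-sq    : ∀ i → M ⊢ (i ∷ i ∷ []) ∼ []
  ∼-braid : ∀ i j n → ¬ (i ≡ j) → m M i j ≡ just n → M ⊢ alt i j n ∼ []

Reduced : ∀ {k} → CoxeterMatrix k → Word k → Set
Reduced {k} M u = ∀ (u' : Word k) → M ⊢ u' ∼ u → length u ≤ length u'

-- Right weak Bruhat order on W (elements represented by words w, w'):
-- some reduced word for w extends on the right to a reduced word for w'.
_⊢_≤B_ : ∀ {k} → CoxeterMatrix k → Word k → Word k → Set
_⊢_≤B_ {k} M w w' =
  Σ (Word k) λ u → Σ (Word k) λ v →
    (M ⊢ u ∼ w) × Reduced M u × (M ⊢ (u ++ v) ∼ w') × Reduced M (u ++ v)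

stepWord : ∀ {k} → Fin (suc k) → Word k
stepWord Data.Fin.zero    = []
stepWord (Data.Fin.suc i) = i ∷ []

position : ∀ {k n} → Vec (Fin (suc k)) n → Word k
position []       = []
position (c ∷ cs) = stepWord c ++ position cs

allFins : ∀ k → List (Fin k)
allFins zero    = []
allFins (suc k) = Data.Fin.zero ∷ map Data.Fin.suc (allFins k)

allWalks : ∀ k n → List (Vec (Fin (suc k)) n)
allWalks k zero    = [] ∷ []
allWalks k (suc n) = concat (map (λ c → map (c ∷_) (allWalks k n)) (allFins (suc k)))

data Count {A : Set} (P : A → Set) : List A → ℕ → Set where
  c-nil : Count P [] 0
  c-yes : ∀ {x xs c} → P x → Count P xs c → Count P (x ∷ xs) (suc c)
  c-no  : ∀ {x xs c} → ¬ P x → Count P xs c → Count P (x ∷ xs) c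

IsPⁿ : ∀ {k} → CoxeterMatrix k → ℕ → Word k → ℚ → Set
IsPⁿ {k} M n x p =
  Σ ℕ λ c → Count (λ ω → M ⊢ position ω ∼ x) (allWalks k n) c
          × (p ≡ _/_ (+ c) (suc k ^ n) {{m^n≢0 (suc k) n}})

{-# OPTIONS --safe #-}

-- Conditioning on the first step, Pⁿ⁺¹(x) is the average of Pⁿ(x) and the Pⁿ(tx), t ∈ S.
-- Call s an ascent of w if the reflection r = wsw⁻¹ occurs an even number of times
-- among the reflections s₁…sᵢ…s₁ of a word s₁…sₗ for w; this parity depends on w only, and
-- s is an ascent of w whenever the word for w extended by s is reduced.  By induction on n,
-- Pⁿ(ws) ≤ Pⁿ(w) for every ascent: if t ≠ r then s is an ascent of tw as well, and if t = r,
-- then tw = ws and tws = w, so that the steps t and 1 contribute the same to both sides.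
-- At most one t equals r because distinct generators are distinct in W; this is seen in
-- a reflection representation over a group on which every odd m has an m-th "root of unity" ξ.
-- Neither the word problem nor equality of reflections is decided: inequalities of
-- natural numbers are stable, so finitely many case distinctions can be made under ¬¬.
module Submission where

open import Defs
open import Data.Bool using (if_then_else_)
open import Data.Fin using (Fin; zero; suc; punchIn; _≟_)
open import Data.Fin.Properties using (punchInᵢ≢i; sequence; any?)
open import Data.Integer as ℤ using (ℤ; 0ℤ; 1ℤ) renaming (_+_ to _+ℤ_; _-_ to _-ℤ_)
import Data.Integer.Properties as ℤₚ
import Data.Integer.Tactic.RingSolver as ℤ-Solver
open import Data.List using (List; []; _∷_; _++_; map; [_]; length; concat; foldr; applyUpTo)
open import Data.List.Properties
  using (++-assoc; ++-identityʳ; map-++; map-∘; map-id; map-applyUpTo; length-++; foldr-++)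
open import Data.List.Relation.Unary.All as All using (All; []; _∷_)
import Data.List.Relation.Unary.All.Properties as Allₚ
open import Data.Maybe using (Maybe; just; nothing)
open import Data.Nat
  using (ℕ; zero; suc; _+_; _*_; _^_; _≤_; _≤?_; _<_; s≤s; z≤n; NonZero; parity)
open import Data.Nat.DivMod
  using ( _/_; _%_; %-distribˡ-+; [m+n]%n≡m%n; [m+kn]%n≡m%n; m%n%n≡m%n; m%n<n; n%n≡0; m<n⇒m%n≡m
        ; m≡m%n+[m/n]*n; +-distrib-/-∣ʳ; m<n⇒m/n≡0; m*n/n≡m)
open import Data.Nat.Divisibility using (n∣m*n)
open import Data.Nat.ListAction using (sum)
open import Data.Nat.Properties
  using ( +-suc; +-comm; +-identityʳ; +-mono-≤; +-monoʳ-≤; +-cancelʳ-≤; *-comm; *-distribʳ-+; m^n≢0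
        ; ≤-refl; ≤-trans; ≤-reflexive; <-≤-trans; <⇒≱; m≤m+n; +-0-commutativeMonoid; module ≤-Reasoning)
import Data.Nat.Tactic.RingSolver as ℕ-Solver
open import Data.Parity.Base as ℙ using (0ℙ; 1ℙ)
open import Data.Parity.Properties using (+-homo-+; p+p≡0ℙ) renaming (_≟_ to _≟ℙ_)
open import Data.Product using (∃; ∃₂; _×_; _,_; proj₁; proj₂)
import Data.Rational as ℚ
import Data.Rational.Properties as ℚₚ
import Data.Rational.Unnormalised as ℚᵘ
import Data.Rational.Unnormalised.Properties as ℚᵘₚ
open import Data.Vec using (_∷_)
open import Effect.Monad using (RawMonad)
open import Function using (_∘_)
open import Relation.Nullary using (¬_; Dec; yes; no; does; contradiction; ¬¬-excluded-middle)
open import Relation.Nullary.Decidable using (decidable-stable; dec-true; dec-false)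
open import Relation.Nullary.Negation using (¬¬-Monad)
open import Relation.Binary.PropositionalEquality hiding ([_])
open import Algebra.Properties.AbelianGroup ℤₚ.+-0-abelianGroup using (∙-cancelʳ)
open import Algebra.Properties.CommutativeMonoid.Sum +-0-commutativeMonoid
  using () renaming (sum to ∑; sum-remove to ∑-remove)
open import Algebra.Properties.CommutativeMonoid.Sum ℤₚ.+-0-commutativeMonoid
  using () renaming (sum to ∑ℤ; sum-remove to ∑ℤ-remove; sum-cong-≗ to ∑ℤ-cong)

-- The discrete wave equation

Wave : (ℕ → ℕ → ℤ) → Set
Wave Y = ∀ n i → Y (2 + n) (1 + i) +ℤ Y n (1 + i) ≡ Y (1 + n) (2 + i) +ℤ Y (1 + n) i

-- Four diamond equations are added and that of an overlap is subtracted; the inner corners cancel.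
glue-diamonds : ∀ a b c d e f g h x y z w →
  a +ℤ b ≡ c +ℤ d → e +ℤ f ≡ g +ℤ h →
  c +ℤ g ≡ x +ℤ y → d +ℤ h ≡ z +ℤ w → b +ℤ e ≡ z +ℤ y →
  a +ℤ f ≡ x +ℤ w
glue-diamonds a b c d e f g h x y z w p q r s t = begin
  a +ℤ f                                   ≡⟨ l₁ a b e f ⟩
  (a +ℤ b) +ℤ (e +ℤ f) -ℤ (b +ℤ e)         ≡⟨ cong₂ _-ℤ_ (cong₂ _+ℤ_ p q) t ⟩
  (c +ℤ d) +ℤ (g +ℤ h) -ℤ (z +ℤ y)         ≡⟨ l₂ c d g h z y ⟩
  (c +ℤ g) +ℤ (d +ℤ h) -ℤ (z +ℤ y)         ≡⟨ cong (_-ℤ (z +ℤ y)) (cong₂ _+ℤ_ r s) ⟩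
  (x +ℤ y) +ℤ (z +ℤ w) -ℤ (z +ℤ y)         ≡⟨ l₃ x y z w ⟩
  x +ℤ w                                   ∎
  where
  open ≡-Reasoning
  l₁ : ∀ a b e f → a +ℤ f ≡ (a +ℤ b) +ℤ (e +ℤ f) -ℤ (b +ℤ e)
  l₁ = ℤ-Solver.solve-∀
  l₂ : ∀ c d g h z y → (c +ℤ d) +ℤ (g +ℤ h) -ℤ (z +ℤ y) ≡ (c +ℤ g) +ℤ (d +ℤ h) -ℤ (z +ℤ y)
  l₂ = ℤ-Solver.solve-∀
  l₃ : ∀ x y z w → (x +ℤ y) +ℤ (z +ℤ w) -ℤ (z +ℤ y) ≡ x +ℤ w
  l₃ = ℤ-Solver.solve-∀

∑< : ℕ → (ℕ → ℤ) → ℤ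
∑< zero    g = 0ℤ
∑< (suc l) g = ∑< l g +ℤ g l

∑<-cong : ∀ l {f g} → (∀ j → f j ≡ g j) → ∑< l f ≡ ∑< l g
∑<-cong zero    e = refl
∑<-cong (suc l) e = cong₂ _+ℤ_ (∑<-cong l e) (e l)

∑<-first : ∀ l (g : ℕ → ℤ) → ∑< (suc l) g ≡ g 0 +ℤ ∑< l (λ j → g (suc j))
∑<-first zero    g = ℤₚ.+-comm 0ℤ (g 0)
∑<-first (suc l) g =
  trans (cong (_+ℤ g (suc l)) (∑<-first l g)) (ℤₚ.+-assoc (g 0) _ _)

∑<-ends : ∀ l (g : ℕ → ℤ) → ∑< (2 + l) g ≡ (g (suc l) +ℤ g 0) +ℤ ∑< l (λ j → g (suc j))
∑<-ends l g = trans (cong (_+ℤ g (suc l)) (∑<-first l g)) (e (g 0) _ (g (suc l)))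
  where
  e : ∀ a b c → a +ℤ b +ℤ c ≡ (c +ℤ a) +ℤ b
  e = ℤ-Solver.solve-∀

∑<-telescope : ∀ l (g : ℕ → ℤ) → ∑< l (λ j → g (suc j) -ℤ g j) ≡ g l -ℤ g 0
∑<-telescope zero    g = sym (ℤₚ.+-inverseʳ (g 0))
∑<-telescope (suc l) g = trans (cong (_+ℤ (g (suc l) -ℤ g l)) (∑<-telescope l g)) (e (g l) (g 0) (g (suc l)))
  where
  e : ∀ a b c → a -ℤ b +ℤ (c -ℤ a) ≡ c -ℤ b
  e = ℤ-Solver.solve-∀

module _ (Y : ℕ → ℕ → ℤ) (wave : Wave Y) where

  -- The parallelogram identity of d'Alembert. A diamond of half-width `j + 2` is assembled from
  -- unit diamonds at its first and last time and two diamonds of half-width `j + 1` side by side,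
  -- which overlap in one of half-width `j`.
  wave-diamond : ∀ j n i →
    Y (j * 2 + n) (j + i) +ℤ Y n (j + i) ≡ Y (j + n) (j * 2 + i) +ℤ Y (j + n) i
  wave-diamond zero n i = refl
  wave-diamond (suc zero) n i = wave n i
  wave-diamond (suc (suc j)) n i
    with wave-diamond (suc j) (suc n) (2 + i) | wave-diamond (suc j) (suc n) i
       | wave-diamond j (2 + n) (2 + i)
  ... | r | s | t
    rewrite +-suc (j * 2) (suc n) | +-suc (j * 2) n | +-suc j (suc n) | +-suc j n
          | +-suc j (suc i) | +-suc j i | +-suc (j * 2) (suc i) | +-suc (j * 2) i
    = glue-diamonds
              (Y (4 + j * 2 + n) (2 + j + i)) (Y (2 + j * 2 + n) (2 + j + i))
              (Y (3 + j * 2 + n) (3 + j + i)) (Y (3 + j * 2 + n) (1 + j + i))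
              (Y (2 + n) (2 + j + i)) (Y n (2 + j + i)) (Y (1 + n) (3 + j + i)) (Y (1 + n) (1 + j + i))
              (Y (2 + j + n) (4 + j * 2 + i)) (Y (2 + j + n) (2 + i))
              (Y (2 + j + n) (2 + j * 2 + i)) (Y (2 + j + n) i)
              (wave (2 + (j * 2 + n)) (suc (j + i))) (wave n (suc (j + i))) r s t

  -- The two windows form a cross with a common centre. The diamond identity equates the sums of
  -- their end points, and a smaller cross remains.
  wave-window : ∀ h n i →
    ∑< (1 + h * 2) (λ l → Y (l + n) (h + i)) ≡ ∑< (1 + h * 2) (λ l → Y (h + n) (l + i))
  wave-window zero n i = refl
  wave-window (suc h) n i = begin
    ∑< (3 + h * 2) (λ l → Y (l + n) (suc h + i))
      ≡⟨ ∑<-ends (1 + h * 2) _ ⟩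
    (Y (2 + h * 2 + n) (suc h + i) +ℤ Y n (suc h + i)) +ℤ ∑< (1 + h * 2) (λ l → Y (suc l + n) (suc h + i))
      ≡⟨ cong₂ _+ℤ_ (wave-diamond (suc h) n i)
           (trans (∑<-cong (1 + h * 2) (λ l → cong₂ Y (sym (+-suc l n)) (sym (+-suc h i))))
           (trans (wave-window h (suc n) (suc i))
                  (∑<-cong (1 + h * 2) (λ l → cong₂ Y (+-suc h n) (+-suc l i))))) ⟩
    (Y (suc h + n) (2 + h * 2 + i) +ℤ Y (suc h + n) i) +ℤ ∑< (1 + h * 2) (λ l → Y (suc h + n) (suc l + i))
      ≡⟨ ∑<-ends (1 + h * 2) _ ⟨
    ∑< (3 + h * 2) (λ l → Y (suc h + n) (l + i)) ∎
    where open ≡-Reasoning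

∑<-minus : ∀ l (f g : ℕ → ℤ) → ∑< l (λ j → f j -ℤ g j) ≡ ∑< l f -ℤ ∑< l g
∑<-minus zero    f g = refl
∑<-minus (suc l) f g = trans (cong (_+ℤ (f l -ℤ g l)) (∑<-minus l f g)) (e (∑< l f) (∑< l g) (f l) (g l))
  where
  e : ∀ a b c d → a -ℤ b +ℤ (c -ℤ d) ≡ a +ℤ c -ℤ (b +ℤ d)
  e = ℤ-Solver.solve-∀

∑<-shift : ∀ l (g : ℕ → ℤ) → g l -ℤ g 0 ≡ ∑< l (λ j → g (suc j)) -ℤ ∑< l g
∑<-shift l g = begin
  g l -ℤ g 0                                                    ≡⟨ e (∑< l g) (g l) (g 0) ⟩
  (∑< l g +ℤ g l) -ℤ g 0 -ℤ ∑< l g                              ≡⟨ cong (λ s → s -ℤ g 0 -ℤ ∑< l g) (∑<-first l g) ⟩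
  (g 0 +ℤ ∑< l (λ j → g (suc j))) -ℤ g 0 -ℤ ∑< l g              ≡⟨ e′ (g 0) (∑< l (λ j → g (suc j))) (∑< l g) ⟩
  ∑< l (λ j → g (suc j)) -ℤ ∑< l g                              ∎
  where
  open ≡-Reasoning
  e : ∀ a b c → b -ℤ c ≡ (a +ℤ b) -ℤ c -ℤ a
  e = ℤ-Solver.solve-∀
  e′ : ∀ a b c → (a +ℤ b) -ℤ a -ℤ c ≡ b -ℤ c
  e′ = ℤ-Solver.solve-∀

-- Differences D in i remove the terms K, and differences Y of D in n remove the force Q
-- of period 2, so Y satisfies the free wave equation, whose sums over N consecutive times
-- equal sums over N consecutive places, which vanish.  Hence the sums U have period 2 in n;
-- as N is odd, the changes of D over two successive intervals of length N cancel.
module DrivenWave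
  (h : ℕ) (C Q : ℕ → ℕ → ℤ) (K : ℕ → ℤ)
  (drive : ∀ n i → C (2 + n) (1 + i) +ℤ C n (1 + i)
                   ≡ C (1 + n) (2 + i) +ℤ C (1 + n) i -ℤ K (1 + n) +ℤ Q n (1 + i))
  (Q-alternates : ∀ n i → Q (2 + n) i ≡ Q n i)
  (C-origin : ∀ n → C n 0 ≡ 0ℤ)
  (C-periodic : ∀ n i → C n (1 + h * 2 + i) ≡ C n i)
  where

  private
    N : ℕ
    N = 1 + h * 2

    D Y U : ℕ → ℕ → ℤ
    D n i = C n (1 + i) -ℤ C n i
    Y n i = D (2 + n) i -ℤ D n i
    U n i = ∑< N (λ l → D (l + n) i)

  D-drive : ∀ n i → D (2 + n) (1 + i) +ℤ D n (1 + i)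
            ≡ D (1 + n) (2 + i) +ℤ D (1 + n) i +ℤ (Q n (2 + i) -ℤ Q n (1 + i))
  D-drive n i = begin
    D (2 + n) (1 + i) +ℤ D n (1 + i)
      ≡⟨ l₁ (C (2 + n) (2 + i)) (C n (2 + i)) (C (2 + n) (1 + i)) (C n (1 + i)) ⟩
    (C (2 + n) (2 + i) +ℤ C n (2 + i)) -ℤ (C (2 + n) (1 + i) +ℤ C n (1 + i))
      ≡⟨ cong₂ _-ℤ_ (drive n (1 + i)) (drive n i) ⟩
    (C (1 + n) (3 + i) +ℤ C (1 + n) (1 + i) -ℤ K (1 + n) +ℤ Q n (2 + i))
      -ℤ (C (1 + n) (2 + i) +ℤ C (1 + n) i -ℤ K (1 + n) +ℤ Q n (1 + i))
      ≡⟨ l₂ (C (1 + n) (3 + i)) (C (1 + n) (1 + i)) (C (1 + n) (2 + i)) (C (1 + n) i)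
            (K (1 + n)) (Q n (2 + i)) (Q n (1 + i)) ⟩
    D (1 + n) (2 + i) +ℤ D (1 + n) i +ℤ (Q n (2 + i) -ℤ Q n (1 + i)) ∎
    where
    open ≡-Reasoning
    l₁ : ∀ a b c d → (a -ℤ c) +ℤ (b -ℤ d) ≡ (a +ℤ b) -ℤ (c +ℤ d)
    l₁ = ℤ-Solver.solve-∀
    l₂ : ∀ p q r s k x y →
      (p +ℤ q -ℤ k +ℤ x) -ℤ (r +ℤ s -ℤ k +ℤ y) ≡ (p -ℤ r) +ℤ (q -ℤ s) +ℤ (x -ℤ y)
    l₂ = ℤ-Solver.solve-∀

  Y-wave : Wave Y
  Y-wave n i = begin
    Y (2 + n) (1 + i) +ℤ Y n (1 + i)
      ≡⟨ l₁ (D (4 + n) (1 + i)) (D (2 + n) (1 + i)) (D n (1 + i)) ⟩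
    (D (4 + n) (1 + i) +ℤ D (2 + n) (1 + i)) -ℤ (D (2 + n) (1 + i) +ℤ D n (1 + i))
      ≡⟨ cong₂ _-ℤ_ (D-drive (2 + n) i) (D-drive n i) ⟩
    (D (3 + n) (2 + i) +ℤ D (3 + n) i +ℤ (Q (2 + n) (2 + i) -ℤ Q (2 + n) (1 + i)))
      -ℤ (D (1 + n) (2 + i) +ℤ D (1 + n) i +ℤ (Q n (2 + i) -ℤ Q n (1 + i)))
      ≡⟨ cong (λ q → (D (3 + n) (2 + i) +ℤ D (3 + n) i +ℤ q)
                     -ℤ (D (1 + n) (2 + i) +ℤ D (1 + n) i +ℤ (Q n (2 + i) -ℤ Q n (1 + i))))
              (cong₂ _-ℤ_ (Q-alternates n (2 + i)) (Q-alternates n (1 + i))) ⟩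
    (D (3 + n) (2 + i) +ℤ D (3 + n) i +ℤ (Q n (2 + i) -ℤ Q n (1 + i)))
      -ℤ (D (1 + n) (2 + i) +ℤ D (1 + n) i +ℤ (Q n (2 + i) -ℤ Q n (1 + i)))
      ≡⟨ l₂ (D (3 + n) (2 + i)) (D (3 + n) i) (D (1 + n) (2 + i)) (D (1 + n) i) (Q n (2 + i) -ℤ Q n (1 + i)) ⟩
    Y (1 + n) (2 + i) +ℤ Y (1 + n) i ∎
    where
    open ≡-Reasoning
    l₁ : ∀ a b c → (a -ℤ b) +ℤ (b -ℤ c) ≡ (a +ℤ b) -ℤ (b +ℤ c)
    l₁ = ℤ-Solver.solve-∀
    l₂ : ∀ a b c d q → (a +ℤ b +ℤ q) -ℤ (c +ℤ d +ℤ q) ≡ (a -ℤ c) +ℤ (b -ℤ d)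
    l₂ = ℤ-Solver.solve-∀

  ∑D≡0 : ∀ n i → ∑< N (λ l → D n (l + i)) ≡ 0ℤ
  ∑D≡0 n i = trans (∑<-telescope N (λ l → C n (l + i))) (ℤₚ.i≡j⇒i-j≡0 (C-periodic n i))

  -- A sum of `Y` over `N` times becomes one over `N` places, where `∑D≡0` applies. The window of
  -- places is centred, so only places from `h` on are reached; `U-alternates` gets the others by
  -- periodicity.
  U-alternates-beyond : ∀ n i → U (2 + n) (h + i) ≡ U n (h + i)
  U-alternates-beyond n i = ℤₚ.i-j≡0⇒i≡j _ _ (begin
    U (2 + n) (h + i) -ℤ U n (h + i)
      ≡⟨ ∑<-minus N (λ l → D (l + (2 + n)) (h + i)) (λ l → D (l + n) (h + i)) ⟨
    ∑< N (λ l → D (l + (2 + n)) (h + i) -ℤ D (l + n) (h + i))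
      ≡⟨ ∑<-cong N (λ l → cong (λ j → D j (h + i) -ℤ D (l + n) (h + i))
                               (trans (+-suc l (suc n)) (cong suc (+-suc l n)))) ⟩
    ∑< N (λ l → Y (l + n) (h + i))
      ≡⟨ wave-window Y Y-wave h n i ⟩
    ∑< N (λ l → Y (h + n) (l + i))
      ≡⟨ ∑<-minus N (λ l → D (2 + (h + n)) (l + i)) (λ l → D (h + n) (l + i)) ⟩
    ∑< N (λ l → D (2 + (h + n)) (l + i)) -ℤ ∑< N (λ l → D (h + n) (l + i))
      ≡⟨ cong₂ _-ℤ_ (∑D≡0 (2 + (h + n)) i) (∑D≡0 (h + n) i) ⟩
    0ℤ ∎)
    where open ≡-Reasoning

  D-periodic : ∀ n i → D n (N + i) ≡ D n i
  D-periodic n i =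
    cong₂ _-ℤ_ (trans (cong (C n) (sym (+-suc N i))) (C-periodic n (suc i))) (C-periodic n i)

  U-alternates : ∀ n i → U (2 + n) i ≡ U n i
  U-alternates n i = begin
    U (2 + n) i                    ≡⟨ U-periodic (2 + n) ⟨
    U (2 + n) (N + i)              ≡⟨ cong (U (2 + n)) (split h i) ⟩
    U (2 + n) (h + (1 + h + i))    ≡⟨ U-alternates-beyond n (1 + h + i) ⟩
    U n (h + (1 + h + i))          ≡⟨ cong (U n) (split h i) ⟨
    U n (N + i)                    ≡⟨ U-periodic n ⟩
    U n i                          ∎
    where
    open ≡-Reasoning
    U-periodic : ∀ n → U n (N + i) ≡ U n i
    U-periodic n = ∑<-cong N (λ l → D-periodic (l + n) i)
    split : ∀ h i → 1 + h * 2 + i ≡ h + (1 + h + i)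
    split = ℕ-Solver.solve-∀

  U-alternates* : ∀ j n i → U (j * 2 + n) i ≡ U n i
  U-alternates* zero    n i = refl
  U-alternates* (suc j) n i = trans (U-alternates (j * 2 + n) i) (U-alternates* j n i)

  D-shift : ∀ n i → D (N + n) i -ℤ D n i ≡ U (1 + n) i -ℤ U n i
  D-shift n i = trans (∑<-shift N (λ l → D (l + n) i))
    (cong (_-ℤ U n i) (∑<-cong N (λ l → cong (λ j → D j i) (sym (+-suc l n)))))

  D-return : ∀ n i → D (N + (N + n)) i ≡ D n i
  D-return n i = begin
    D (N + (N + n)) i
      ≡⟨ l₁ (D (N + (N + n)) i) (D (N + n) i) (D n i) ⟩
    (D (N + (N + n)) i -ℤ D (N + n) i) +ℤ (D (N + n) i -ℤ D n i) +ℤ D n i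
      ≡⟨ cong (_+ℤ D n i) (cong₂ _+ℤ_ (D-shift (N + n) i) (D-shift n i)) ⟩
    (U (1 + (N + n)) i -ℤ U (N + n) i) +ℤ (U (1 + n) i -ℤ U n i) +ℤ D n i
      ≡⟨ cong (λ u → u +ℤ (U (1 + n) i -ℤ U n i) +ℤ D n i) (cong₂ _-ℤ_ even odd) ⟩
    (U n i -ℤ U (1 + n) i) +ℤ (U (1 + n) i -ℤ U n i) +ℤ D n i
      ≡⟨ l₂ (U n i) (U (1 + n) i) (D n i) ⟩
    D n i ∎
    where
    open ≡-Reasoning
    l₁ : ∀ a b c → a ≡ (a -ℤ b) +ℤ (b -ℤ c) +ℤ c
    l₁ = ℤ-Solver.solve-∀
    l₂ : ∀ a b c → (a -ℤ b) +ℤ (b -ℤ a) +ℤ c ≡ c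
    l₂ = ℤ-Solver.solve-∀
    -- As `1 + N` is even and `N` is odd, alternation of `U` makes the second change of `D` the
    -- negative of the first.
    even : U (1 + (N + n)) i ≡ U n i
    even = U-alternates* (suc h) n i
    odd : U (N + n) i ≡ U (1 + n) i
    odd = trans (cong (λ j → U j i) (sym (+-suc (h * 2) n))) (U-alternates* h (1 + n) i)

  -- `C` is rebuilt from the origin, where it vanishes, by adding its differences `D`.
  C-return : ∀ n i → C (N + (N + n)) i ≡ C n i
  C-return n zero    = trans (C-origin _) (sym (C-origin n))
  C-return n (suc i) = begin
    C (N + (N + n)) (suc i)                          ≡⟨ l (C (N + (N + n)) (suc i)) (C (N + (N + n)) i) ⟩
    D (N + (N + n)) i +ℤ C (N + (N + n)) i           ≡⟨ cong₂ _+ℤ_ (D-return n i) (C-return n i) ⟩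
    D n i +ℤ C n i                                   ≡⟨ l (C n (suc i)) (C n i) ⟨
    C n (suc i)                                      ∎
    where
    open ≡-Reasoning
    l : ∀ a b → a ≡ (a -ℤ b) +ℤ b
    l = ℤ-Solver.solve-∀

-- Integer sequences as modules over cyclotomic integers

%-cong-+ : ∀ x {a b} m .{{_ : NonZero m}} → a % m ≡ b % m → (x + a) % m ≡ (x + b) % m
%-cong-+ x {a} {b} m e = begin
  (x + a) % m            ≡⟨ %-distribˡ-+ x a m ⟩
  (x % m + a % m) % m    ≡⟨ cong (λ r → (x % m + r) % m) e ⟩
  (x % m + b % m) % m    ≡⟨ %-distribˡ-+ x b m ⟨
  (x + b) % m            ∎
  where open ≡-Reasoning

%-cancel-suc : ∀ {a b} m .{{_ : NonZero m}} → suc a % m ≡ suc b % m → a % m ≡ b % m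
%-cancel-suc {a} {b} m@(suc d) e = begin
  a % m              ≡⟨ [m+n]%n≡m%n a m ⟨
  (a + m) % m        ≡⟨ cong (_% m) (trans (+-comm a m) (sym (+-suc d a))) ⟩
  (d + suc a) % m    ≡⟨ %-cong-+ d m e ⟩
  (d + suc b) % m    ≡⟨ cong (_% m) (trans (+-suc d b) (+-comm m b)) ⟩
  (b + m) % m        ≡⟨ [m+n]%n≡m%n b m ⟩
  b % m              ∎
  where open ≡-Reasoning

-- ℕ → ℤ as a module over ℤ[ξ]/(1 + ξ + … + ξᴺ⁻¹), N = e + 2: the q-th block of N − 1
-- values of f encodes a function on ℤ/N modulo constants, represented by the function
-- cyc f q vanishing at 0, and ξ translates ℤ/N; subtracting drift restores the value 0 at 0.
-- Using the same group ℕ → ℤ for all N spares a ring containing all the roots of unity;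
-- the operators for different N need not commute.
module Cyclotomic (e : ℕ) where

  d N : ℕ
  d = suc e
  N = suc d

  digit : (ℕ → ℤ) → ℕ → ℕ → ℤ
  digit f q zero    = 0ℤ
  digit f q (suc r) = f (r + q * d)

  cyc : (ℕ → ℤ) → ℕ → ℕ → ℤ
  cyc f q i = digit f q (i % N)

  drift : (ℕ → ℤ) → ℕ → ℤ
  drift f q = cyc f q 1 +ℤ cyc f q d

  ξ+ξ⁻¹ : (ℕ → ℤ) → ℕ → ℤ
  ξ+ξ⁻¹ f n = cyc f (n / d) (2 + n % d) +ℤ cyc f (n / d) (n % d) -ℤ drift f (n / d)

  cyc-suc : ∀ f q r → r < d → cyc f q (suc r) ≡ f (r + q * d)
  cyc-suc f q r r<d = cong (digit f q) (m<n⇒m%n≡m (s≤s r<d))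

  cyc-periodic : ∀ f q i → cyc f q (N + i) ≡ cyc f q i
  cyc-periodic f q i = cong (digit f q) (trans (cong (_% N) (+-comm N i)) ([m+n]%n≡m%n i N))

  cyc-linear : ∀ {a b c f} → (∀ t → a t +ℤ b t ≡ c t +ℤ f t) →
    ∀ q i → cyc a q i +ℤ cyc b q i ≡ cyc c q i +ℤ cyc f q i
  cyc-linear eq q i with i % N
  ... | zero  = refl
  ... | suc r = eq (r + q * d)

  cyc-ξ+ξ⁻¹ : ∀ f q i → cyc (ξ+ξ⁻¹ f) q (suc i) ≡ cyc f q (2 + i) +ℤ cyc f q i -ℤ drift f q
  cyc-ξ+ξ⁻¹ f q i = go (suc i % N) refl
    where
    open ≡-Reasoning
    go : ∀ r → suc i % N ≡ r → digit (ξ+ξ⁻¹ f) q r ≡ cyc f q (2 + i) +ℤ cyc f q i -ℤ drift f q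
    -- Here `suc i` is 0 modulo `N`, so `2 + i` and `i` are the places 1 and `d`, whose values add
    -- up to `drift`.
    go zero eq = sym (ℤₚ.i≡j⇒i-j≡0 (cong₂ _+ℤ_
      (cong (digit f q) (%-cong-+ 1 {suc i} {0} N eq))
      (cong (digit f q) (%-cancel-suc {i} {d} N (trans eq (sym (n%n≡0 N)))))))
    go (suc r) eq = begin
      ξ+ξ⁻¹ f (r + q * d)
        ≡⟨ cong₂ (λ a b → cyc f a (2 + b) +ℤ cyc f a b -ℤ drift f a) quotient remainder ⟩
      cyc f q (2 + r) +ℤ cyc f q r -ℤ drift f q
        ≡⟨ cong (_-ℤ drift f q) (cong₂ _+ℤ_
             (cong (digit f q) (%-cong-+ 1 {suc r} {suc i} N suc-r≡suc-i))
             (cong (digit f q) (%-cancel-suc {r} {i} N suc-r≡suc-i))) ⟩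
      cyc f q (2 + i) +ℤ cyc f q i -ℤ drift f q ∎
      where
      suc-r≡suc-i : suc r % N ≡ suc i % N
      suc-r≡suc-i = trans (cong (_% N) (sym eq)) (m%n%n≡m%n (suc i) N)
      r<d : r < d
      r<d with subst (_< N) eq (m%n<n (suc i) N)
      ... | s≤s lt = lt
      remainder : (r + q * d) % d ≡ r
      remainder = trans ([m+kn]%n≡m%n r q d) (m<n⇒m%n≡m r<d)
      quotient : (r + q * d) / d ≡ q
      quotient = begin
        (r + q * d) / d        ≡⟨ +-distrib-/-∣ʳ r (n∣m*n q) ⟩
        r / d + q * d / d      ≡⟨ cong₂ _+_ (m<n⇒m/n≡0 r<d) (m*n/n≡m q d) ⟩
        q                      ∎

  cyc-determines : ∀ {f g} → (∀ q i → cyc f q i ≡ cyc g q i) → ∀ t → f t ≡ g t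
  cyc-determines {f} {g} eq t = begin
    f t                            ≡⟨ cong f (m≡m%n+[m/n]*n t d) ⟩
    f (t % d + t / d * d)          ≡⟨ cyc-suc f (t / d) (t % d) (m%n<n t d) ⟨
    cyc f (t / d) (suc (t % d))    ≡⟨ eq (t / d) (suc (t % d)) ⟩
    cyc g (t / d) (suc (t % d))    ≡⟨ cyc-suc g (t / d) (t % d) (m%n<n t d) ⟩
    g (t % d + t / d * d)          ≡⟨ cong g (m≡m%n+[m/n]*n t d) ⟨
    g t                            ∎
    where open ≡-Reasoning

  digit-cong : ∀ {f g} → (∀ t → f t ≡ g t) → ∀ q r → digit f q r ≡ digit g q r
  digit-cong eq q zero    = refl
  digit-cong eq q (suc r) = eq (r + q * d)

  ξ+ξ⁻¹-cong : ∀ {f g} → (∀ t → f t ≡ g t) → ∀ n → ξ+ξ⁻¹ f n ≡ ξ+ξ⁻¹ g n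
  ξ+ξ⁻¹-cong eq n = cong₂ _-ℤ_
    (cong₂ _+ℤ_ (cyc-cong (2 + n % d)) (cyc-cong (n % d)))
    (cong₂ _+ℤ_ (cyc-cong 1) (cyc-cong d))
    where
    cyc-cong : ∀ i → digit _ (n / d) (i % N) ≡ digit _ (n / d) (i % N)
    cyc-cong i = digit-cong eq (n / d) (i % N)

  -- On each block, `cyc` turns the recursion into a driven wave on ℤ/N: `drift` is the term
  -- independent of the place, and `P` is the force of period 2.
  ξ+ξ⁻¹-return : ∀ h → N ≡ 1 + h * 2 → (y P : ℕ → ℕ → ℤ) →
    (∀ n t → y (2 + n) t +ℤ y n t ≡ ξ+ξ⁻¹ (y (1 + n)) t +ℤ P n t) →
    (∀ n t → P (2 + n) t ≡ P n t) →
    ∀ n t → y (N + (N + n)) t ≡ y n t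
  ξ+ξ⁻¹-return h N≡ y P rec alternates n = cyc-determines (λ q i →
    subst (λ N′ → cyc (y (N′ + (N′ + n))) q i ≡ cyc (y n) q i) (sym N≡)
      (DrivenWave.C-return h (λ n → cyc (y n) q) (λ n → cyc (P n) q) (λ n → drift (y n) q)
        (λ n i → trans (cyc-linear {y (2 + n)} {y n} (rec n) q (suc i))
                       (cong (_+ℤ cyc (P n) q (suc i)) (cyc-ξ+ξ⁻¹ (y (1 + n)) q i)))
        (λ n i → digit-cong (alternates n) q (i % N))
        (λ n → refl)
        (λ n i → trans (cong (λ N′ → cyc (y n) q (N′ + i)) (sym N≡)) (cyc-periodic (y n) q i))
        n i))

-- Coupling operators and their return times

even⇒half : ∀ n → parity n ≡ 0ℙ → ∃ λ h → n ≡ h * 2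
even⇒half zero          _ = 0 , refl
even⇒half (suc (suc n)) p with even⇒half n p
... | h , e = suc h , cong (2 +_) e

odd⇒half : ∀ n → parity n ≡ 1ℙ → ∃ λ h → n ≡ 1 + h * 2
odd⇒half (suc zero)    _ = 0 , refl
odd⇒half (suc (suc n)) p with odd⇒half n p
... | h , e = suc h , cong (2 +_) e

-- With ξᵐ = 1 and m odd, the coupling ξ + ξ⁻¹ gives a product of two reflections with
-- eigenvalues ξ², ξ⁻², of order dividing m.  For m even or infinite the reflections may commute.
couple : Maybe ℕ → (ℕ → ℤ) → ℕ → ℤ
couple (just (suc (suc e))) f with parity e
... | 0ℙ = λ _ → 0ℤ
... | 1ℙ = Cyclotomic.ξ+ξ⁻¹ e f
couple _ f = λ _ → 0ℤ

-- Without coupling, the recursion at `n` and at `2 + n` gives period 4 in time, and 4 divides twice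
-- an even number.
uncoupled-return : (y P : ℕ → ℕ → ℤ) →
  (∀ n t → y (2 + n) t +ℤ y n t ≡ 0ℤ +ℤ P n t) → (∀ n t → P (2 + n) t ≡ P n t) →
  ∀ h n t → y (h * 2 + (h * 2 + n)) t ≡ y n t
uncoupled-return y P rec alternates zero    n t = refl
uncoupled-return y P rec alternates (suc h) n t
  rewrite +-suc (h * 2) (suc (h * 2 + n)) | +-suc (h * 2) (h * 2 + n) =
  trans (step (h * 2 + (h * 2 + n))) (uncoupled-return y P rec alternates h n t)
  where
  open ≡-Reasoning
  step : ∀ n → y (4 + n) t ≡ y n t
  step n = ∙-cancelʳ (y (2 + n) t) (y (4 + n) t) (y n t) (begin
    y (4 + n) t +ℤ y (2 + n) t    ≡⟨ rec (2 + n) t ⟩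
    0ℤ +ℤ P (2 + n) t             ≡⟨ cong (0ℤ +ℤ_) (alternates n t) ⟩
    0ℤ +ℤ P n t                   ≡⟨ rec n t ⟨
    y (2 + n) t +ℤ y n t          ≡⟨ ℤₚ.+-comm (y (2 + n) t) (y n t) ⟩
    y n t +ℤ y (2 + n) t          ∎)

-- The braid relation of exponent `m` is a product of `2 m` generators, hence a return after `2 m`
-- steps is what it requires.
couple-return : ∀ m → 2 ≤ m → (y P : ℕ → ℕ → ℤ) →
  (∀ n t → y (2 + n) t +ℤ y n t ≡ couple (just m) (y (1 + n)) t +ℤ P n t) →
  (∀ n t → P (2 + n) t ≡ P n t) →
  ∀ n t → y (m + (m + n)) t ≡ y n t
couple-return (suc (suc e)) (s≤s (s≤s z≤n)) y P rec alternates n t with parity e in eq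
... | 0ℙ with even⇒half e eq
...   | h , refl = uncoupled-return y P rec alternates (suc h) n t
couple-return (suc (suc e)) (s≤s (s≤s z≤n)) y P rec alternates n t | 1ℙ with odd⇒half e eq
... | h , e≡ = Cyclotomic.ξ+ξ⁻¹-return e (suc h) (cong (2 +_) e≡) y P rec alternates n t

couple-cong : ∀ o {f g} → (∀ t → f t ≡ g t) → ∀ t → couple o f t ≡ couple o g t
couple-cong nothing eq t = refl
couple-cong (just zero) eq t = refl
couple-cong (just (suc zero)) eq t = refl
couple-cong (just (suc (suc e))) eq t with parity e
... | 0ℙ = refl
... | 1ℙ = Cyclotomic.ξ+ξ⁻¹-cong e eq t

-- The reflection representation

∑ℤ-change : ∀ {k} (b : Fin k) (F G : Fin k → ℤ) → (∀ c → c ≢ b → F c ≡ G c) →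
  ∑ℤ F ≡ F b +ℤ (∑ℤ G -ℤ G b)
∑ℤ-change {suc k} b F G eq = begin
  ∑ℤ F                                                   ≡⟨ ∑ℤ-remove F ⟩
  F b +ℤ ∑ℤ (λ i → F (punchIn b i))
    ≡⟨ cong (F b +ℤ_) (∑ℤ-cong (λ i → eq (punchIn b i) (punchInᵢ≢i b i))) ⟩
  F b +ℤ ∑ℤ (λ i → G (punchIn b i))
    ≡⟨ cong (F b +ℤ_) (e (G b) _) ⟩
  F b +ℤ (G b +ℤ ∑ℤ (λ i → G (punchIn b i)) -ℤ G b)
    ≡⟨ cong (λ s → F b +ℤ (s -ℤ G b)) (∑ℤ-remove G) ⟨
  F b +ℤ (∑ℤ G -ℤ G b)                                   ∎
  where
  open ≡-Reasoning
  e : ∀ a b → b ≡ a +ℤ b -ℤ a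
  e = ℤ-Solver.solve-∀

module Representation {k} (M : CoxeterMatrix k) where

  V : Set
  V = Fin k → ℕ → ℤ

  K : Fin k → Fin k → (ℕ → ℤ) → ℕ → ℤ
  K a b f with a ≟ b
  ... | yes _ = λ _ → 0ℤ
  ... | no  _ = couple (m M a b) f

  K-cong : ∀ a b {f g} → (a ≢ b → ∀ t → f t ≡ g t) → ∀ t → K a b f t ≡ K a b g t
  K-cong a b eq t with a ≟ b
  ... | yes _   = refl
  ... | no  a≢b = couple-cong (m M a b) (eq a≢b) t

  K-couple : ∀ {a b} → a ≢ b → ∀ f t → K a b f t ≡ couple (m M a b) f t
  K-couple {a} {b} a≢b f t with a ≟ b
  ... | yes a≡b = contradiction a≡b a≢b
  ... | no  _   = refl

  pull : Fin k → V → ℕ → ℤ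
  pull a v t = ∑ℤ (λ b → K a b (v b) t)

  pull-cong : ∀ a {v w : V} → (∀ b → a ≢ b → ∀ t → v b t ≡ w b t) → ∀ t → pull a v t ≡ pull a w t
  pull-cong a eq t = ∑ℤ-cong (λ b → K-cong a b (eq b) t)

  -- In coordinates with respect to the simple roots, this is the classical reflection with each
  -- factor 2cos(π/m) replaced by the operator `couple`.
  reflect : Fin k → V → V
  reflect a v b with a ≟ b
  ... | yes _ = λ t → pull a v t -ℤ v b t
  ... | no  _ = v b

  reflect-self : ∀ a v t → reflect a v a t ≡ pull a v t -ℤ v a t
  reflect-self a v t with a ≟ a
  ... | yes _   = refl
  ... | no  a≢a = contradiction refl a≢a

  reflect-other : ∀ {a b} v → a ≢ b → ∀ t → reflect a v b t ≡ v b t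
  reflect-other {a} {b} v a≢b t with a ≟ b
  ... | yes a≡b = contradiction a≡b a≢b
  ... | no  _   = refl

  reflect-cong : ∀ a {v w : V} → (∀ b t → v b t ≡ w b t) → ∀ b t → reflect a v b t ≡ reflect a w b t
  reflect-cong a eq b t with a ≟ b
  ... | yes _ = cong₂ _-ℤ_ (pull-cong a (λ b _ → eq b) t) (eq b t)
  ... | no  _ = eq b t

  reflect-involutive : ∀ a v b t → reflect a (reflect a v) b t ≡ v b t
  reflect-involutive a v b t with a ≟ b
  ... | no a≢b   = reflect-other v a≢b t
  ... | yes refl = begin
    pull a (reflect a v) t -ℤ reflect a v a t
      ≡⟨ cong₂ _-ℤ_ (pull-cong a (λ b → reflect-other v) t) (reflect-self a v t) ⟩
    pull a v t -ℤ (pull a v t -ℤ v a t)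
      ≡⟨ e (pull a v t) (v a t) ⟩
    v a t ∎
    where
    open ≡-Reasoning
    e : ∀ p x → p -ℤ (p -ℤ x) ≡ x
    e = ℤ-Solver.solve-∀

  act : Word k → V → V
  act u v = foldr reflect v u

  act-cong : ∀ u {v w : V} → (∀ b t → v b t ≡ w b t) → ∀ b t → act u v b t ≡ act u w b t
  act-cong []      eq = eq
  act-cong (a ∷ u) eq = reflect-cong a (act-cong u eq)

  -- In the alternating application of reflect a and reflect b, y n is the coordinate that
  -- the n-th reflection is about to change, and P n the contribution to its new value of the
  -- coordinates other than a and b, which never change.
  module Dihedral (a b : Fin k) (a≢b : a ≢ b) (v : V) where

    turn : ℕ → Fin k
    turn 0             = a
    turn 1             = b
    turn (suc (suc n)) = turn n

    x : ℕ → V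
    x zero    = v
    x (suc n) = reflect (turn n) (x n)

    y P : ℕ → ℕ → ℤ
    y n = x n (turn n)
    P n t = pull (turn n) v t -ℤ K (turn n) (turn (1 + n)) (v (turn (1 + n))) t

    turn≢ : ∀ n → turn n ≢ turn (1 + n)
    turn≢ 0             = a≢b
    turn≢ 1             = ≢-sym a≢b
    turn≢ (suc (suc n)) = turn≢ n

    m-turn : ∀ n → m M (turn n) (turn (1 + n)) ≡ m M a b
    m-turn 0             = refl
    m-turn 1             = m-sym M b a
    m-turn (suc (suc n)) = m-turn n

    turn-fixes : ∀ {c} → a ≢ c → b ≢ c → ∀ n → turn n ≢ c
    turn-fixes a≢c b≢c 0             = a≢c
    turn-fixes a≢c b≢c 1             = b≢c
    turn-fixes a≢c b≢c (suc (suc n)) = turn-fixes a≢c b≢c n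

    turn-covers : ∀ n {c} → c ≢ turn n → c ≢ turn (1 + n) → ∀ n → turn n ≢ c
    turn-covers 0             p q = turn-fixes (≢-sym p) (≢-sym q)
    turn-covers 1             p q = turn-fixes (≢-sym q) (≢-sym p)
    turn-covers (suc (suc n)) p q = turn-covers n p q

    x-other : ∀ {c} → (∀ n → turn n ≢ c) → ∀ n t → x n c t ≡ v c t
    x-other fixes zero    t = refl
    x-other fixes (suc n) t = trans (reflect-other (x n) (fixes n) t) (x-other fixes n t)

    x-next : ∀ n t → x n (turn (1 + n)) t ≡ y (1 + n) t
    x-next n t = sym (reflect-other (x n) (turn≢ n) t)

    recurrence : ∀ n t → y (2 + n) t +ℤ y n t ≡ couple (m M a b) (y (1 + n)) t +ℤ P n t
    recurrence n t = begin
      y (2 + n) t +ℤ y n t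
        -- Step `1 + n` moves the other coordinate, so the value found at time `2 + n` is the one
        -- produced by step `n`.
        ≡⟨ cong (_+ℤ y n t) (trans (reflect-other (x (1 + n)) (≢-sym (turn≢ n)) t)
                                   (reflect-self (turn n) (x n) t)) ⟩
      pull (turn n) (x n) t -ℤ y n t +ℤ y n t
        ≡⟨ e (pull (turn n) (x n) t) (y n t) ⟩
      pull (turn n) (x n) t
        -- The coordinate `turn n` does not pull on itself; of the others, only `turn (1 + n)` may
        -- differ from its value in `v`.
        ≡⟨ ∑ℤ-change (turn (1 + n)) _ _ (λ c c≢ → K-cong (turn n) c (λ ≢c →
             x-other (turn-covers n (≢-sym ≢c) c≢) n) t) ⟩
      K (turn n) (turn (1 + n)) (x n (turn (1 + n))) t +ℤ P n t
        ≡⟨ cong (_+ℤ P n t) (trans (K-couple (turn≢ n) _ t)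
             (trans (cong (λ o → couple o (x n (turn (1 + n))) t) (m-turn n))
                    (couple-cong (m M a b) (x-next n) t))) ⟩
      couple (m M a b) (y (1 + n)) t +ℤ P n t ∎
      where
      open ≡-Reasoning
      e : ∀ p x → p -ℤ x +ℤ x ≡ p
      e = ℤ-Solver.solve-∀

    turn-even : ∀ n → turn (n * 2) ≡ a
    turn-even zero    = refl
    turn-even (suc n) = turn-even n

    turn-odd : ∀ n → turn (1 + n * 2) ≡ b
    turn-odd zero    = refl
    turn-odd (suc n) = turn-odd n

    act-alt : ∀ n → act (alt b a n) v ≡ x (n * 2)
    act-alt zero    = refl
    act-alt (suc n) rewrite turn-even n | turn-odd n = cong (λ w → reflect b (reflect a w)) (act-alt n)

    module _ {n} (m≡ : m M a b ≡ just n) where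

      y-return : ∀ l t → y (n + (n + l)) t ≡ y l t
      y-return = couple-return n (m-≥2 M a b a≢b n m≡) y P
        (λ l t → subst (λ o → y (2 + l) t +ℤ y l t ≡ couple o (y (1 + l)) t +ℤ P l t) m≡ (recurrence l t))
        (λ l t → refl)

      n+n≡n*2 : n + (n + 0) ≡ n * 2
      n+n≡n*2 = *-comm 2 n

      alt-fixes : ∀ c t → act (alt b a n) v c t ≡ v c t
      alt-fixes c t rewrite act-alt n with a ≟ c | b ≟ c
      ... | yes refl | _ = begin
        x (n * 2) a t                  ≡⟨ cong (λ c → x (n * 2) c t) (turn-even n) ⟨
        y (n * 2) t                    ≡⟨ cong (λ l → y l t) n+n≡n*2 ⟨
        y (n + (n + 0)) t              ≡⟨ y-return 0 t ⟩
        v a t                          ∎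
        where open ≡-Reasoning
      -- At time `n * 2` it is the turn of `a`, so the coordinate `b` already has the value
      -- `y (1 + n * 2)` that it has one step later.
      ... | no _ | yes refl = begin
        x (n * 2) b t                  ≡⟨ cong (λ c → x (n * 2) c t) (turn-odd n) ⟨
        x (n * 2) (turn (1 + n * 2)) t ≡⟨ x-next (n * 2) t ⟩
        y (1 + n * 2) t                ≡⟨ cong (λ l → y (suc l) t) n+n≡n*2 ⟨
        y (1 + (n + (n + 0))) t
          ≡⟨ cong (λ l → y l t) (trans (cong (n +_) (+-suc n 0)) (+-suc n (n + 0))) ⟨
        y (n + (n + 1)) t              ≡⟨ y-return 1 t ⟩
        y 1 t                          ≡⟨ x-next 0 t ⟨
        v b t                          ∎
        where open ≡-Reasoning
      ... | no a≢c | no b≢c = x-other (turn-fixes a≢c b≢c) (n * 2) t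

  act-sound : ∀ {u w} → M ⊢ u ∼ w → ∀ v c t → act u v c t ≡ act w v c t
  act-sound ∼-refl v c t = refl
  act-sound (∼-sym e) v c t = sym (act-sound e v c t)
  act-sound (∼-trans e f) v c t = trans (act-sound e v c t) (act-sound f v c t)
  act-sound (∼-cong {u} {w} p q e) v c t
    rewrite foldr-++ reflect v p (u ++ q) | foldr-++ reflect v p (w ++ q)
          | foldr-++ reflect v u q | foldr-++ reflect v w q
    = act-cong p (act-sound e (act q v)) c t
  act-sound (∼-sq i) v c t = reflect-involutive i v c t
  act-sound (∼-braid i j n i≢j m≡) v c t =
    -- The last letter of a word acts first, so `j` plays the part of `a`.
    Dihedral.alt-fixes j i (≢-sym i≢j) v (trans (m-sym M j i) m≡) c t

  -- If i and j represented the same element, reflect i would fix the coordinate i, so 2 v i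
  -- would depend on the other coordinates of v only.
  generators-distinct : ∀ {i j} → M ⊢ [ i ] ∼ [ j ] → i ≡ j
  generators-distinct {i} {j} i∼j = decidable-stable (i ≟ j) λ i≢j →
    absurd (trans (sym (doubled i≢j (λ _ _ → 0ℤ)))
           (trans (pull-cong i (λ b i≢b t → sym (δ-other i≢b)) 0)
           (trans (doubled i≢j (λ b _ → δ b)) (cong₂ _+ℤ_ δ-self δ-self))))
    where
    absurd : ¬ 0ℤ ≡ 1ℤ +ℤ 1ℤ
    absurd ()

    δ : Fin k → ℤ
    δ b = if does (i ≟ b) then 1ℤ else 0ℤ

    δ-self : δ i ≡ 1ℤ
    δ-self = cong (if_then 1ℤ else 0ℤ) (dec-true (i ≟ i) refl)

    δ-other : ∀ {b} → i ≢ b → δ b ≡ 0ℤ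
    δ-other {b} i≢b = cong (if_then 1ℤ else 0ℤ) (dec-false (i ≟ b) i≢b)

    doubled : i ≢ j → ∀ v → pull i v 0 ≡ v i 0 +ℤ v i 0
    doubled i≢j v = begin
      pull i v 0                       ≡⟨ e (pull i v 0) (v i 0) ⟩
      pull i v 0 -ℤ v i 0 +ℤ v i 0     ≡⟨ cong (_+ℤ v i 0) (reflect-self i v 0) ⟨
      act [ i ] v i 0 +ℤ v i 0         ≡⟨ cong (_+ℤ v i 0) (act-sound i∼j v i 0) ⟩
      act [ j ] v i 0 +ℤ v i 0         ≡⟨ cong (_+ℤ v i 0) (reflect-other v (≢-sym i≢j) 0) ⟩
      v i 0 +ℤ v i 0                   ∎
      where
      open ≡-Reasoning
      e : ∀ p x → p ≡ p -ℤ x +ℤ x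
      e = ℤ-Solver.solve-∀

-- Counting up to double negation

module _ {A : Set} where

  -- `P` may be undecidable; finitely many instances of excluded middle, one for each entry, are
  -- used under the double negation.
  count-exists : ∀ (P : A → Set) xs → ¬ ¬ ∃ (Count P xs)
  count-exists P []       k = k (0 , c-nil)
  count-exists P (x ∷ xs) k = count-exists P xs λ (c , cs) → ¬¬-excluded-middle λ
    { (yes p) → k (suc c , c-yes p cs)
    ; (no ¬p) → k (c , c-no ¬p cs) }

  count-unique : ∀ {P Q : A → Set} → (∀ {x} → P x → Q x) → (∀ {x} → Q x → P x) →
    ∀ {xs c d} → Count P xs c → Count Q xs d → c ≡ d
  count-unique f g c-nil       c-nil       = refl
  count-unique f g (c-yes p a) (c-yes q b) = cong suc (count-unique f g a b)
  count-unique f g (c-yes p a) (c-no ¬q b) = contradiction (f p) ¬q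
  count-unique f g (c-no ¬p a) (c-yes q b) = contradiction (g q) ¬p
  count-unique f g (c-no ¬p a) (c-no ¬q b) = count-unique f g a b

  count-resp : ∀ {P Q : A → Set} → (∀ {x} → P x → Q x) → (∀ {x} → Q x → P x) →
    ∀ {xs c} → Count P xs c → Count Q xs c
  count-resp f g c-nil       = c-nil
  count-resp f g (c-yes p n) = c-yes (f p) (count-resp f g n)
  count-resp f g (c-no ¬p n) = c-no (¬p ∘ g) (count-resp f g n)

  count-++⁻ : ∀ {P : A → Set} xs {ys c} → Count P (xs ++ ys) c →
    ∃₂ λ a b → Count P xs a × Count P ys b × c ≡ a + b
  count-++⁻ []       n = 0 , _ , c-nil , n , refl
  count-++⁻ (x ∷ xs) (c-yes p n) with count-++⁻ xs n
  ... | a , b , l , r , refl = suc a , b , c-yes p l , r , refl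
  count-++⁻ (x ∷ xs) (c-no ¬p n) with count-++⁻ xs n
  ... | a , b , l , r , refl = a , b , c-no ¬p l , r , refl

  count-map⁻ : ∀ {B : Set} {P : A → Set} (f : B → A) xs {c} → Count P (map f xs) c → Count (P ∘ f) xs c
  count-map⁻ f []       c-nil       = c-nil
  count-map⁻ f (x ∷ xs) (c-yes p n) = c-yes p (count-map⁻ f xs n)
  count-map⁻ f (x ∷ xs) (c-no ¬p n) = c-no ¬p (count-map⁻ f xs n)

  count-none : ∀ {P : A → Set} {xs c} → All (¬_ ∘ P) xs → Count P xs c → c ≡ 0
  count-none []        c-nil       = refl
  count-none (¬p ∷ ps) (c-yes p n) = contradiction p ¬p
  count-none (¬p ∷ ps) (c-no _ n)  = count-none ps n

  count-applyUpTo : ∀ {P Q : A → Set} (f g : ℕ → A) →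
    (∀ i → P (f i) → Q (g i)) → (∀ i → Q (g i) → P (f i)) →
    ∀ n {c d} → Count P (applyUpTo f n) c → Count Q (applyUpTo g n) d → c ≡ d
  count-applyUpTo f g to from zero    c-nil       c-nil       = refl
  count-applyUpTo f g to from (suc n) (c-yes p a) (c-yes q b) =
    cong suc (count-applyUpTo (f ∘ suc) (g ∘ suc) (to ∘ suc) (from ∘ suc) n a b)
  count-applyUpTo f g to from (suc n) (c-yes p a) (c-no ¬q b) = contradiction (to 0 p) ¬q
  count-applyUpTo f g to from (suc n) (c-no ¬p a) (c-yes q b) = contradiction (from 0 q) ¬p
  count-applyUpTo f g to from (suc n) (c-no ¬p a) (c-no ¬q b) =
    count-applyUpTo (f ∘ suc) (g ∘ suc) (to ∘ suc) (from ∘ suc) n a b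

  applyUpTo-+ : ∀ (f : ℕ → A) m n → applyUpTo f (m + n) ≡ applyUpTo f m ++ applyUpTo (f ∘ (m +_)) n
  applyUpTo-+ f zero    n = refl
  applyUpTo-+ f (suc m) n = cong (f 0 ∷_) (applyUpTo-+ (f ∘ suc) m n)

-- Reflections and ascents

-- This is utu⁻¹: generators are involutions, so a reversed word represents the inverse.
conj : ∀ {k} → Word k → Word k → Word k
conj []      t = t
conj (s ∷ u) t = s ∷ conj u t ++ [ s ]

-- This is u⁻¹tu.
unconj : ∀ {k} → Word k → Word k → Word k
unconj []      t = t
unconj (s ∷ u) t = unconj u (conj [ s ] t)

-- The reflections s₁…sᵢ…s₁ of the word s₁…sₗ.
refs : ∀ {k} → Word k → List (Word k)
refs []      = []
refs (s ∷ u) = [ s ] ∷ map (conj [ s ]) (refs u)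

refs-++ : ∀ {k} (u v : Word k) → refs (u ++ v) ≡ refs u ++ map (conj u) (refs v)
refs-++ []      v = sym (map-id (refs v))
refs-++ (s ∷ u) v = cong ([ s ] ∷_) (begin
  map (conj [ s ]) (refs (u ++ v))                                    ≡⟨ cong (map _) (refs-++ u v) ⟩
  map (conj [ s ]) (refs u ++ map (conj u) (refs v))                  ≡⟨ map-++ _ (refs u) _ ⟩
  map (conj [ s ]) (refs u) ++ map (conj [ s ]) (map (conj u) (refs v))
    ≡⟨ cong (map (conj [ s ]) (refs u) ++_) (map-∘ (refs v)) ⟨
  map (conj [ s ]) (refs u) ++ map (conj (s ∷ u)) (refs v)            ∎)
  where open ≡-Reasoning

-- Alternating words and their reflections

alternating : ∀ {k} → Fin k → Fin k → ℕ → Word k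
alternating i j zero    = []
alternating i j (suc l) = i ∷ alternating j i l

alt≡alternating : ∀ {k} (i j : Fin k) n → alt i j n ≡ alternating i j (n * 2)
alt≡alternating i j zero    = refl
alt≡alternating i j (suc n) = cong (λ w → i ∷ j ∷ w) (alt≡alternating i j n)

alternating-snoc : ∀ {k} (i j : Fin k) l → alternating i j (suc (l * 2)) ++ [ j ] ≡ alternating i j (2 + l * 2)
alternating-snoc i j zero    = refl
alternating-snoc i j (suc l) = cong (λ w → i ∷ j ∷ w) (alternating-snoc i j l)

alternating-+ : ∀ {k} (i j : Fin k) n l → alternating i j (n * 2 + l) ≡ alternating i j (n * 2) ++ alternating i j l
alternating-+ i j zero    l = refl
alternating-+ i j (suc n) l = cong (λ w → i ∷ j ∷ w) (alternating-+ i j n l)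

-- Conjugation by `i` puts one more letter `i` at each end of an alternating word of odd length that
-- starts and ends in `j`.
refs-alternating : ∀ {k} (i j : Fin k) l → refs (alternating i j l) ≡ applyUpTo (λ d → alternating i j (suc (d * 2))) l
refs-alternating i j zero    = refl
refs-alternating {k} i j (suc l) = cong ([ i ] ∷_) (begin
  map (conj [ i ]) (refs (alternating j i l))
    ≡⟨ cong (map _) (refs-alternating j i l) ⟩
  map (conj [ i ]) (applyUpTo (λ d → alternating j i (suc (d * 2))) l)
    ≡⟨ map-applyUpTo _ _ l ⟩
  applyUpTo (λ d → i ∷ alternating j i (suc (d * 2)) ++ [ i ]) l
    ≡⟨ applyUpTo-cong (λ d → cong (i ∷_) (alternating-snoc j i d)) l ⟩
  applyUpTo (λ d → alternating i j (suc (suc d * 2))) l ∎)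
  where
  open ≡-Reasoning
  applyUpTo-cong : ∀ {f g : ℕ → Word k} → (∀ d → f d ≡ g d) → ∀ l → applyUpTo f l ≡ applyUpTo g l
  applyUpTo-cong e zero    = refl
  applyUpTo-cong e (suc l) = cong₂ _∷_ (e 0) (applyUpTo-cong (e ∘ suc) l)

parity-+ : ∀ a b c d → parity a ≡ parity c → parity b ≡ parity d → parity (a + b) ≡ parity (c + d)
parity-+ a b c d p q = trans (+-homo-+ a b) (trans (cong₂ ℙ._+_ p q) (sym (+-homo-+ c d)))

parity-double : ∀ a → parity (a + a) ≡ 0ℙ
parity-double a = trans (+-homo-+ a a) (p+p≡0ℙ (parity a))

-- Parity of the occurrences of a reflection

module Reflections {k} (M : CoxeterMatrix k) where

  infix 4 _≈_
  _≈_ : Word k → Word k → Set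
  u ≈ v = M ⊢ u ∼ v

  ≡⇒≈ : ∀ {u v} → u ≡ v → u ≈ v
  ≡⇒≈ refl = ∼-refl

  ++-congˡ : ∀ p {u v} → u ≈ v → p ++ u ≈ p ++ v
  ++-congˡ p {u} {v} e =
    subst₂ (λ a b → p ++ a ≈ p ++ b) (++-identityʳ u) (++-identityʳ v) (∼-cong p [] e)

  ++-congʳ : ∀ q {u v} → u ≈ v → u ++ q ≈ v ++ q
  ++-congʳ q e = ∼-cong [] q e

  ++-cong : ∀ {u v p q} → u ≈ v → p ≈ q → u ++ p ≈ v ++ q
  ++-cong {v = v} {p} e f = ∼-trans (++-congʳ p e) (++-congˡ v f)

  ss-cancel : ∀ s u → s ∷ s ∷ u ≈ u
  ss-cancel s u = ++-congʳ u (∼-sq s)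

  ∷-cancel : ∀ s {u v} → s ∷ u ≈ s ∷ v → u ≈ v
  ∷-cancel s {u} {v} e =
    ∼-trans (∼-sym (ss-cancel s u)) (∼-trans (++-congˡ [ s ] e) (ss-cancel s v))

  ++-cancelʳ : ∀ q {u v} → u ++ q ≈ v ++ q → u ≈ v
  ++-cancelʳ []      {u} {v} e = subst₂ _≈_ (++-identityʳ u) (++-identityʳ v) e
  ++-cancelʳ (s ∷ q) {u} {v} e =
    ∼-trans (∼-sym (undo u)) (∼-trans (++-congʳ [ s ] shorter) (undo v))
    where
    shorter : u ++ [ s ] ≈ v ++ [ s ]
    shorter = ++-cancelʳ q (subst₂ _≈_ (sym (++-assoc u [ s ] q)) (sym (++-assoc v [ s ] q)) e)
    undo : ∀ u → (u ++ [ s ]) ++ [ s ] ≈ u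
    undo u = subst₂ _≈_ (sym (++-assoc u [ s ] [ s ])) (++-identityʳ u) (++-congˡ u (∼-sq s))

  conj-commutes : ∀ u t → conj u t ++ u ≈ u ++ t
  conj-commutes []      t = ≡⇒≈ (++-identityʳ t)
  conj-commutes (s ∷ u) t = ∼-trans
    (≡⇒≈ (cong (s ∷_) (++-assoc (conj u t) [ s ] (s ∷ u))))
    (++-congˡ [ s ] (∼-trans (++-congˡ (conj u t) (ss-cancel s u)) (conj-commutes u t)))

  conj≈⇒ : ∀ u {x t} → conj u x ≈ t → u ++ x ≈ t ++ u
  conj≈⇒ u {x} e = ∼-trans (∼-sym (conj-commutes u x)) (++-congʳ u e)

  conj≈⇐ : ∀ u {x t} → u ++ x ≈ t ++ u → conj u x ≈ t
  conj≈⇐ u {x} e = ++-cancelʳ u (∼-trans (conj-commutes u x) e)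

  conj-cong : ∀ u {x y} → x ≈ y → conj u x ≈ conj u y
  conj-cong u {x} {y} e = conj≈⇐ u (∼-trans (++-congˡ u e) (∼-sym (conj-commutes u y)))

  conj-cancel : ∀ u {x y} → conj u x ≈ conj u y → x ≈ y
  conj-cancel []      e = e
  conj-cancel (s ∷ u) e = conj-cancel u (++-cancelʳ [ s ] (∷-cancel s e))

  Occurrences : Word k → Word k → ℕ → Set
  Occurrences t u c = Count (_≈ t) (refs u) c

  -- The `2 n` reflections are the alternating words of odd length. Positions `d` and `n + d` carry
  -- the same group element, since their words differ by the prefix `alt i j n`, which is trivial;
  -- so every reflection occurs equally often in both halves.
  braid-even : ∀ i j n → alt i j n ≈ [] → ∀ {t c} → Occurrences t (alt i j n) c → parity c ≡ 0ℙ
  braid-even i j n e {t} {c} occ with count-++⁻ (applyUpTo f n) (subst (λ xs → Count (_≈ t) xs c) halves occ)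
    where
    f : ℕ → Word k
    f d = alternating i j (suc (d * 2))
    halves : refs (alt i j n) ≡ applyUpTo f n ++ applyUpTo (f ∘ (n +_)) n
    halves = begin
      refs (alt i j n)                               ≡⟨ cong refs (alt≡alternating i j n) ⟩
      refs (alternating i j (n * 2))                 ≡⟨ refs-alternating i j (n * 2) ⟩
      applyUpTo f (n * 2)                            ≡⟨ cong (applyUpTo f) (trans (*-comm n 2) (cong (n +_) (+-identityʳ n))) ⟩
      applyUpTo f (n + n)                            ≡⟨ applyUpTo-+ f n n ⟩
      applyUpTo f n ++ applyUpTo (f ∘ (n +_)) n      ∎
      where open ≡-Reasoning
  ... | a , b , l , r , refl
    with count-applyUpTo _ _ (λ d → ∼-trans (∼-sym (repeat d))) (λ d → ∼-trans (repeat d)) n r l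
    where
    repeat : ∀ d → alternating i j (suc ((n + d) * 2)) ≈ alternating i j (suc (d * 2))
    repeat d = ∼-trans (≡⇒≈ (begin
      alternating i j (suc ((n + d) * 2))                          ≡⟨ cong (alternating i j ∘ suc) (*-distribʳ-+ 2 n d) ⟩
      alternating i j (suc (n * 2 + d * 2))                        ≡⟨ cong (alternating i j) (+-suc (n * 2) (d * 2)) ⟨
      alternating i j (n * 2 + suc (d * 2))                        ≡⟨ alternating-+ i j n (suc (d * 2)) ⟩
      alternating i j (n * 2) ++ alternating i j (suc (d * 2))     ≡⟨ cong (_++ alternating i j (suc (d * 2))) (alt≡alternating i j n) ⟨
      alt i j n ++ alternating i j (suc (d * 2))                   ∎))
      (++-congʳ (alternating i j (suc (d * 2))) e)
      where open ≡-Reasoning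
  ... | refl = parity-double b

  square-even : ∀ i {t c} → Occurrences t (i ∷ i ∷ []) c → parity c ≡ 0ℙ
  square-even i (c-yes p (c-yes q c-nil))  = refl
  square-even i (c-no ¬p (c-no ¬q c-nil))  = refl
  square-even i (c-yes p (c-no ¬q c-nil))  = contradiction (∼-trans (ss-cancel i [ i ]) p) ¬q
  square-even i (c-no ¬p (c-yes q c-nil))  = contradiction (∼-trans (∼-sym (ss-cancel i [ i ])) q) ¬p

  conj-involutive : ∀ s t → conj [ s ] (conj [ s ] t) ≈ t
  conj-involutive s t = conj≈⇐ [ s ] {conj [ s ] t} (ss-cancel s (t ++ [ s ]))

  conj-unconj : ∀ u t → conj u (unconj u t) ≈ t
  conj-unconj []      t = ∼-refl
  conj-unconj (s ∷ u) t = ∼-trans (conj-cong [ s ] (conj-unconj u (conj [ s ] t))) (conj-involutive s t)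

  unconj-cong : ∀ {u v t t′} → u ≈ v → t ≈ t′ → unconj u t ≈ unconj v t′
  unconj-cong {u} {v} {t} {t′} e τ = conj-cancel u (∼-trans (conj-unconj u t)
    (∼-sym (conj≈⇐ u (∼-trans (++-congʳ (unconj v t′) e)
      (∼-trans (conj≈⇒ v (conj-unconj v t′)) (++-cong (∼-sym τ) (∼-sym e)))))))

  -- The reflections from the second factor are conjugated by `u`, so they are compared with u⁻¹tu
  -- before conjugation.
  occurrences-++⁻ : ∀ {t} u {v c} → Occurrences t (u ++ v) c →
    ∃₂ λ a b → Occurrences t u a × Occurrences (unconj u t) v b × c ≡ a + b
  occurrences-++⁻ {t} u {v} {c} n
    with count-++⁻ (refs u) (subst (λ xs → Count (_≈ t) xs c) (refs-++ u v) n)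
  ... | a , b , l , r , e = a , b , l ,
    count-resp (λ p → conj-cancel u (∼-trans p (∼-sym (conj-unconj u t))))
               (λ p → ∼-trans (conj-cong u p) (conj-unconj u t))
               (count-map⁻ (conj u) (refs v) r) , e

  occurrences-unique : ∀ {u t t′ c d} → t ≈ t′ → Occurrences t u c → Occurrences t′ u d → c ≡ d
  occurrences-unique τ = count-unique (λ e → ∼-trans e τ) (λ e → ∼-trans e (∼-sym τ))

  -- Induction on the derivation. Within a context the left factors agree, the middle ones agree in
  -- parity by induction, and the right ones are compared with the same reflection because u⁻¹tu
  -- depends on the element of `u` only. Both kinds of relator contain every reflection an even
  -- number of times.
  occurrences-parity : ∀ {u v} → u ≈ v → ∀ {t t′ c d} → t ≈ t′ →
    Occurrences t u c → Occurrences t′ v d → parity c ≡ parity d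
  occurrences-parity ∼-refl τ a b = cong parity (occurrences-unique τ a b)
  occurrences-parity (∼-sym e) τ a b = sym (occurrences-parity e (∼-sym τ) b a)
  -- A count for the intermediate word exists under double negation; equality of parities is
  -- decidable and hence stable.
  occurrences-parity (∼-trans {v = v} e f) {t} τ a b = decidable-stable (_ ≟ℙ _) λ ≢ →
    count-exists (_≈ t) (refs v) λ (_ , n) →
      ≢ (trans (occurrences-parity e ∼-refl a n) (occurrences-parity f τ n b))
  occurrences-parity (∼-cong {u} {v} p q e) τ a b with occurrences-++⁻ p a | occurrences-++⁻ p b
  ... | a₁ , _ , l , a′ , refl | b₁ , _ , l′ , b′ , refl
    with occurrences-++⁻ u a′ | occurrences-++⁻ v b′
  ... | a₂ , a₃ , m , r , refl | b₂ , b₃ , m′ , r′ , refl =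
    parity-+ a₁ (a₂ + a₃) b₁ (b₂ + b₃) (cong parity (occurrences-unique τ l l′))
      (parity-+ a₂ a₃ b₂ b₃ (occurrences-parity e τ′ m m′)
        (cong parity (occurrences-unique (unconj-cong e τ′) r r′)))
    where τ′ = unconj-cong (∼-refl {u = p}) τ
  occurrences-parity (∼-sq i) τ a c-nil = square-even i a
  occurrences-parity (∼-braid i j n i≢j m≡) τ a c-nil = braid-even i j n (∼-braid i j n i≢j m≡) a

  Ascent : Word k → Fin k → Set
  Ascent w s = ∀ {c} → Occurrences (conj w [ s ]) w c → parity c ≡ 0ℙ

  -- With r = wsw⁻¹, the reflection for `t ∷ w` is trt. It equals the first reflection t only if r =
  -- t, that is tw = ws; the other reflections are those of `w` conjugated by t, so they contain trt
  -- as often as `w` contains r.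
  Ascent-∷ : ∀ {w s} t → Ascent w s → ¬ t ∷ w ≈ w ++ [ s ] → Ascent (t ∷ w) s
  Ascent-∷ {w} {s} t ascent ≉ (c-yes p n) = contradiction
    (∼-sym (conj≈⇒ w (conj-cancel [ t ] (∼-trans (∼-sym p) (∼-sym (ss-cancel t [ t ]))))))
    ≉
  Ascent-∷ {w} t ascent ≉ (c-no ¬p n) = ascent
    (count-resp (conj-cancel [ t ]) (conj-cong [ t ]) (count-map⁻ (conj [ t ]) (refs w) n))

  -- If ws = 1, then w = s, and the word s contains its reflection exactly once.
  Ascent⇒≉[] : ∀ {w s} → Ascent w s → ¬ [] ≈ w ++ [ s ]
  Ascent⇒≉[] {w} {s} ascent e = count-exists (_≈ conj w [ s ]) (refs w) λ (_ , n) →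
    contradiction (trans (sym (ascent n)) (occurrences-parity w≈s r≈s n (c-yes ∼-refl c-nil))) λ ()
    where
    w≈s : w ≈ [ s ]
    w≈s = ++-cancelʳ [ s ] (∼-trans (∼-sym e) (∼-sym (∼-sq s)))
    r≈s : conj w [ s ] ≈ [ s ]
    r≈s = conj≈⇐ w (++-cong w≈s (∼-sym w≈s))

  -- The exchange argument: multiplying s₁...sₗ on the left by s₁...sᵢ...s₁ deletes the letter sᵢ.
  refs-shorten : ∀ u → All (λ t → ∃ λ v → length v < length u × t ++ u ≈ v) (refs u)
  refs-shorten []      = []
  refs-shorten (s ∷ u) = (u , ≤-refl , ss-cancel s u) ∷
    Allₚ.map⁺ (All.map (λ {t} (v , shorter , e) → s ∷ v , s≤s shorter ,
      ++-congˡ [ s ] (∼-trans (≡⇒≈ (++-assoc t [ s ] (s ∷ u)))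
                     (∼-trans (++-congˡ t (ss-cancel s u)) e))) (refs-shorten u))

  -- If usu⁻¹ were among the reflections of `u`, the exchange argument would give a word for us
  -- shorter than `u`. So it occurs zero times.
  reduced⇒Ascent : ∀ u s → Reduced M (u ++ [ s ]) → Ascent u s
  reduced⇒Ascent u s reduced n = cong parity (count-none
    (All.map (λ {t} (v , shorter , e) t≈r → <⇒≱ (<-≤-trans shorter (longer u))
        (reduced v (∼-trans (∼-sym e) (∼-sym (conj≈⇒ u (∼-sym t≈r))))))
      (refs-shorten u)) n)
    where
    longer : ∀ u → length u ≤ length (u ++ [ s ])
    longer u = ≤-trans (m≤m+n (length u) 1) (≤-reflexive (sym (length-++ u)))

-- The walk

¬¬-∀ : ∀ {n} {P : Fin n → Set} → (∀ i → ¬ ¬ P i) → ¬ ¬ (∀ i → P i)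
¬¬-∀ = sequence (RawMonad.rawApplicative ¬¬-Monad)

∑-mono : ∀ {n} {a b : Fin n → ℕ} → (∀ i → b i ≤ a i) → ∑ b ≤ ∑ a
∑-mono {zero}  le = z≤n
∑-mono {suc n} le = +-mono-≤ (le zero) (∑-mono (le ∘ suc))

-- For the generator `e` that equals the reflection: resting and stepping by `e` swap their
-- contributions.
∑-exchange : ∀ {n} {a b : Fin n → ℕ} {a₀ b₀} e → b e ≡ a₀ → a e ≡ b₀ →
  (∀ i → i ≢ e → b i ≤ a i) → b₀ + ∑ b ≤ a₀ + ∑ a
∑-exchange {suc n} {a} {b} {a₀} {b₀} e refl refl le = begin
  a e + ∑ b                            ≡⟨ cong (a e +_) (∑-remove b) ⟩
  a e + (b e + ∑ (b ∘ punchIn e))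
    ≤⟨ +-monoʳ-≤ (a e) (+-monoʳ-≤ (b e) (∑-mono (λ i → le (punchIn e i) (punchInᵢ≢i e i)))) ⟩
  a e + (b e + ∑ (a ∘ punchIn e))      ≡⟨ swap (a e) (b e) _ ⟩
  b e + (a e + ∑ (a ∘ punchIn e))      ≡⟨ cong (b e +_) (∑-remove a) ⟨
  b e + ∑ a                            ∎
  where
  open ≤-Reasoning
  swap : ∀ x y z → x + (y + z) ≡ y + (x + z)
  swap = ℕ-Solver.solve-∀

count-concat : ∀ {A I : Set} {P : A → Set} (g : I → List A) (a : I → ℕ) →
  (∀ i {c} → Count P (g i) c → c ≡ a i) →
  ∀ is {c} → Count P (concat (map g is)) c → c ≡ sum (map a is)
count-concat g a eq []       c-nil = refl
count-concat g a eq (i ∷ is) n with count-++⁻ (g i) n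
... | _ , _ , l , r , refl = cong₂ _+_ (eq i l) (count-concat g a eq is r)

sum-allFins : ∀ {n} (a : Fin n → ℕ) → sum (map a (allFins n)) ≡ ∑ a
sum-allFins {zero}  a = refl
sum-allFins {suc n} a = cong (a zero +_) (trans (cong sum (sym (map-∘ (allFins n)))) (sum-allFins (a ∘ suc)))

module Walk {k} (M : CoxeterMatrix k) where
  open Reflections M
  open Representation M using (generators-distinct)

  Visits : ℕ → Word k → ℕ → Set
  Visits n x c = Count (λ ω → position ω ≈ x) (allWalks k n) c

  visits-unique : ∀ {n x y c d} → x ≈ y → Visits n x c → Visits n y d → c ≡ d
  visits-unique e = count-unique (λ p → ∼-trans p e) (λ p → ∼-trans p (∼-sym e))

  step-flip : ∀ t {u v} → stepWord t ++ u ≈ v → u ≈ stepWord t ++ v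
  step-flip zero    e = e
  step-flip (suc i) e = ∼-trans (∼-sym (ss-cancel i _)) (++-congˡ [ i ] e)

  step-flip⁻¹ : ∀ t {u v} → u ≈ stepWord t ++ v → stepWord t ++ u ≈ v
  step-flip⁻¹ zero    e = e
  step-flip⁻¹ (suc i) e = ∼-trans (++-congˡ [ i ] e) (ss-cancel i _)

  -- The first step is the leftmost letter of the position and its own inverse, so the remaining
  -- steps must lead to `stepWord t ++ x`.
  visits-suc : ∀ {n x c} (a : Fin (suc k) → ℕ) → (∀ t → Visits n (stepWord t ++ x) (a t)) →
    Visits (suc n) x c → c ≡ ∑ a
  visits-suc {n} a va v = trans
    (count-concat _ a (λ t m → count-unique (step-flip t) (step-flip⁻¹ t)
                                 (count-map⁻ (t ∷_) (allWalks k n) m) (va t))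
                  (allFins (suc k)) v)
    (sum-allFins a)

  ¬¬-visits : ∀ n x → ¬ ¬ ∃ λ a → ∀ t → Visits n (stepWord t ++ x) (a t)
  ¬¬-visits n x ¬v = ¬¬-∀ (λ t → count-exists (λ ω → position ω ≈ stepWord t ++ x) (allWalks k n))
    λ v → ¬v (proj₁ ∘ v , proj₂ ∘ v)

  visits-ascent : ∀ n {w s c d} → Ascent w s → Visits n w c → Visits n (w ++ [ s ]) d → d ≤ c
  -- A walk of no steps visits ws only if ws = 1, which an ascent excludes.
  visits-ascent zero ascent vc (c-yes p c-nil) = contradiction p (Ascent⇒≉[] ascent)
  visits-ascent zero ascent vc (c-no _ c-nil)  = z≤n
  visits-ascent (suc n) {w} {s} {c} {d} ascent vc vd = decidable-stable (d ≤? c) λ d≰c →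
    ¬¬-visits n w λ (a , va) → ¬¬-visits n (w ++ [ s ]) λ (b , vb) →
    -- For each generator it is settled whether it equals the reflection wsw⁻¹.
    ¬¬-∀ (λ i → ¬¬-excluded-middle {A = i ∷ w ≈ w ++ [ s ]}) λ fold? →
    d≰c (subst₂ _≤_ (sym (visits-suc b vb vd)) (sym (visits-suc a va vc)) (compare a b va vb fold?))
    where
    compare : ∀ a b → (∀ t → Visits n (stepWord t ++ w) (a t)) →
      (∀ t → Visits n (stepWord t ++ w ++ [ s ]) (b t)) →
      (∀ i → Dec (i ∷ w ≈ w ++ [ s ])) → ∑ b ≤ ∑ a
    compare a b va vb fold? with any? fold?
    ... | no none = +-mono-≤ (visits-ascent n ascent (va zero) (vb zero))
      (∑-mono (λ i → visits-ascent n (Ascent-∷ i ascent (λ p → none (i , p))) (va (suc i)) (vb (suc i))))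
    ... | yes (e , p) = ∑-exchange e
      (visits-unique ews≈w (vb (suc e)) (va zero))
      (visits-unique p (va (suc e)) (vb zero))
      λ i i≢e → visits-ascent n
        -- If `i` were the reflection too, `i` and `e` would be the same element of the group.
        (Ascent-∷ i ascent (λ q → i≢e (generators-distinct (++-cancelʳ w (∼-trans q (∼-sym p))))))
        (va (suc i)) (vb (suc i))
      where
      ews≈w : e ∷ w ++ [ s ] ≈ w
      ews≈w = ∼-trans (++-congˡ [ e ] (∼-sym p)) (ss-cancel e w)

  reduced-prefix : ∀ u v → Reduced M (u ++ v) → Reduced M u
  reduced-prefix u v reduced u′ e = +-cancelʳ-≤ (length v) (length u) (length u′)
    (subst₂ _≤_ (length-++ u) (length-++ u′) (reduced (u′ ++ v) (++-congʳ v e)))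

  -- The letters of `v` are appended one at a time; each is an ascent, since prefixes of reduced
  -- words are reduced.
  visits-reduced : ∀ n u v {c d} → Reduced M (u ++ v) → Visits n u c → Visits n (u ++ v) d → d ≤ c
  visits-reduced n u [] reduced vc vd =
    ≤-reflexive (visits-unique (≡⇒≈ (++-identityʳ u)) vd vc)
  visits-reduced n u (s ∷ v) {c} {d} reduced vc vd
    rewrite sym (++-assoc u [ s ] v) = decidable-stable (d ≤? c) λ d≰c →
      count-exists (λ ω → position ω ≈ u ++ [ s ]) (allWalks k n) λ (_ , vm) →
      d≰c (≤-trans (visits-reduced n (u ++ [ s ]) v reduced vm vd)
                   (visits-ascent n (reduced⇒Ascent u s (reduced-prefix (u ++ [ s ]) v reduced)) vc vm))

-- From counts to probabilities

/-mono-≤ : ∀ {i j} n .{{_ : NonZero n}} → i ℤ.≤ j → i ℚ./ n ℚ.≤ j ℚ./ n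
/-mono-≤ {i} {j} (suc n) i≤j = ℚₚ.toℚᵘ-cancel-≤
  (ℚᵘₚ.≤-respˡ-≃ (ℚᵘₚ.≃-sym (ℚₚ.toℚᵘ-fromℚᵘ (ℚᵘ.mkℚᵘ i n)))
  (ℚᵘₚ.≤-respʳ-≃ (ℚᵘₚ.≃-sym (ℚₚ.toℚᵘ-fromℚᵘ (ℚᵘ.mkℚᵘ j n)))
  (ℚᵘ.*≤* (ℤₚ.*-monoʳ-≤-nonNeg (ℤ.+ suc n) i≤j))))

theorem1p1 : ∀ {k} (M : CoxeterMatrix k) (n : ℕ) (w w' : Word k) →
    M ⊢ w ≤B w' → ∀ (p p' : ℚ.ℚ) → IsPⁿ M n w p → IsPⁿ M n w' p' → p' ℚ.≤ p
theorem1p1 {k} M n w w' (u , v , u∼w , _ , uv∼w' , reduced) p p' (c , vc , refl) (c' , vc' , refl) =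
  -- Both probabilities have the same denominator, and counts depend only on the group element, so
  -- the words `u` and `u ++ v` may stand for `w` and `w'`.
  /-mono-≤ (suc k ^ n) {{m^n≢0 (suc k) n}} (ℤ.+≤+ (visits-reduced n u v reduced (move u∼w vc) (move uv∼w' vc')))
  where
  open Walk M
  move : ∀ {x y c} → M ⊢ x ∼ y → Visits n y c → Visits n x c
  move e = count-resp (λ p → ∼-trans p (∼-sym e)) (λ p → ∼-trans p e)
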